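{- Let $a$ and $b$ be positive integers with $a\ge 2$, and consider the Pell equation $x^{2}-(a^{2}b^{2}-b)y^{2}=1$. Then the following hold. (i) The continued fraction expansion of $\sqrt{a^{2}b^{2}-b}$ is $$\sqrt{a^{2}b^{2}-b}=\begin{cases}[a-1;\overline{1,2a-2}] & \text{if } b=1,\\ [ab-1;\overline{1,2a-2,1,2ab-2}] & \text{if } b>1.\end{cases}$$ (ii) The fundamental solution of the equation is $$(x_{1},y_{1})=\begin{cases}(a,1) & \text{if } b=1,\\ (2a^{2}b-1,2a) & \text{if } b>1.\end{cases}$$ (iii) The $n$-th solution $(x_{n},y_{n})$ of the equation can be found by $$\frac{x_{n}}{y_{n}}=\begin{cases}[a-1;(1,2a-2)_{n-1},1] & \text{if } b=1,\\ [ab-1;(1,2a-2,1,2ab-2)_{n-1},1] & \text{if } b>1.\end{cases}$$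
   Context: $[a_0;a_1,a_2,\dots]$ denotes the simple continued fraction $a_0+\cfrac{1}{a_1+\cfrac{1}{a_2+\cdots}}$ (finite or infinite), and an overline marks the block of partial quotients that repeats periodically. The notation $(1,2a-2)_{n-1}$, respectively $(1,2a-2,1,2ab-2)_{n-1}$, inside a continued fraction means that there are $n-1$ successive blocks $1,2a-2$, respectively $1,2a-2,1,2ab-2$. For a positive non-square integer $d$, the fundamental solution $(x_1,y_1)$ of $x^2-dy^2=1$ is its smallest solution in positive integers, and the $n$-th solution $(x_n,y_n)$, $n\ge 1$, is given by $x_n+y_n\sqrt d=(x_1+y_1\sqrt d)^n$.
   Formalization: In (iii) for b>1 the printed continued fraction is false (a=b=2, n=1 gives [3;1]=4, but x_1/y_1=15/4); the formal statement instead proves x_n/y_n=[ab-1;(1,2a-2,1,2ab-2)_{n-1},1,2a-2,1]. -}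

module Defs where

import Data.Integer as ℤ
open import Data.List using (List; []; _∷_; applyUpTo; concat; replicate)
open import Data.Nat as ℕ using (ℕ; zero; suc)
open import Data.Nat.DivMod using (_mod_)
open import Data.Product using (Σ-syntax; ∃-syntax; _×_; _,_)
open import Data.Rational.Unnormalised
open import Data.Sum using (_⊎_)
open import Data.Vec using (Vec; lookup)
open import Relation.Binary.PropositionalEquality using (_≡_)

------------------------------------------------------------------------
-- Continued fractions

fromℕ : ℕ → ℚᵘ
fromℕ n = ℤ.+ n / 1

-- Total reciprocal with the convention 1/0 = 0.  The convention is never
-- used when all the partial quotients after the first are positive.
recip : ℚᵘ → ℚᵘ
recip   (mkℚᵘ (ℤ.+ zero)  _) = 0ℚᵘ
recip p@(mkℚᵘ ℤ.+[1+ _ ]  _) = 1/ p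
recip p@(mkℚᵘ ℤ.-[1+ _ ]  _) = 1/ p

[_⨾_] : ℕ → List ℕ → ℚᵘ
[ a ⨾ []     ] = fromℕ a
[ a ⨾ b ∷ bs ] = fromℕ a + recip [ b ⨾ bs ]

convergent : (ℕ → ℕ) → ℕ → ℚᵘ
convergent c k = [ c 0 ⨾ applyUpTo (λ i → c (suc i)) k ]

-- Partial quotients of [a; v, v, v, …], with v repeated forever.
[_⨾‾_] : ∀ {m} → ℕ → Vec ℕ (suc m) → ℕ → ℕ
[_⨾‾_] {m} a v zero    = a
[_⨾‾_] {m} a v (suc k) = lookup v (k mod suc m)

infixl 8 _⟨×_⟩
_⟨×_⟩ : List ℕ → ℕ → List ℕ
block ⟨× n ⟩ = concat (replicate n block)

------------------------------------------------------------------------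
-- The real number √d, given by its Dedekind cut

infix 4 _<√_ √_<_
_<√_ : ℚᵘ → ℕ → Set
q <√ d = q < 0ℚᵘ ⊎ q * q < fromℕ d

√_<_ : ℕ → ℚᵘ → Set
√ d < q = 0ℚᵘ < q × fromℕ d < q * q

-- ∣ s k - √d ∣ < ε for all large k
_ConvergesTo√_ : (ℕ → ℚᵘ) → ℕ → Set
s ConvergesTo√ d = ∀ ε → 0ℚᵘ < ε → ∃[ N ] ∀ k → N ℕ.≤ k →
  (s k - ε <√ d) × (√ d < s k + ε)

-- √d = [c 0; c 1, c 2, …] as an infinite simple continued fraction.
record √_HasExpansion_ (d : ℕ) (c : ℕ → ℕ) : Set where
  field
    quotients-positive : ∀ k → 1 ℕ.≤ c (suc k)
    converges          : convergent c ConvergesTo√ d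

------------------------------------------------------------------------
-- The Pell equation

record IsPositiveSolution (d x y : ℕ) : Set where
  field
    x-positive : 1 ℕ.≤ x
    y-positive : 1 ℕ.≤ y
    equation   : ℤ.+ (x ℕ.^ 2) ℤ.- ℤ.+ (d ℕ.* y ℕ.^ 2) ≡ ℤ.1ℤ

-- Among positive solutions x increases with y, so that "smallest" can be
-- taken in both coordinates at once.
record IsFundamental (d x y : ℕ) : Set where
  field
    solution : IsPositiveSolution d x y
    smallest : ∀ x′ y′ → IsPositiveSolution d x′ y′ → x ℕ.≤ x′ × y ℕ.≤ y′

-- (x , y) stands for x + y √d.
surdMul : ℕ → ℕ × ℕ → ℕ × ℕ → ℕ × ℕ
surdMul d (x , y) (u , v) = x ℕ.* u ℕ.+ d ℕ.* (y ℕ.* v) , x ℕ.* v ℕ.+ y ℕ.* u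

surdPow : ℕ → ℕ × ℕ → ℕ → ℕ × ℕ
surdPow d z zero    = 1 , 0
surdPow d z (suc n) = surdMul d z (surdPow d z n)

IsNthSolution : (d n x y : ℕ) → Set
IsNthSolution d n x y =
  ∃[ x₁ ] ∃[ y₁ ] IsFundamental d x₁ y₁ × (x , y) ≡ surdPow d (x₁ , y₁) n

-- x / y = q, including the claim that the denominator is nonzero.
RatioIs : ℕ → ℕ → ℚᵘ → Set
RatioIs x y q = Σ[ y≢0 ∈ ℕ.NonZero y ] (_/_ (ℤ.+ x) y {{y≢0}}) ≃ q

------------------------------------------------------------------------
-- The family a²b² - b.  All truncated subtractions here and in the
-- partial quotients are exact for a ≥ 2 and b ≥ 1.

disc : ℕ → ℕ → ℕ
disc a b = a ℕ.^ 2 ℕ.* b ℕ.^ 2 ℕ.∸ b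

-- Pitfall: for b > 1 the source gives x_n / y_n as n - 1 blocks
-- 1, 2a-2, 1, 2ab-2 followed by just "1".  That formula fails for every
-- n ≥ 1; for n = 1 it reads [ab-1; 1] = ab, whereas
-- x₁ / y₁ = (2a²b-1) / 2a = [ab-1; 1, 2a-2, 1].  The statement therefore
-- ends with 1, 2a-2, 1: solutions come from the convergents that stop just
-- before the last entry 2ab-2 of a period.

{-# OPTIONS --safe #-}
module Submission where

-- For M = ab − 1, prepending one period to the tail bs of [M; bs] = x / y
-- replaces x + y √d by (u + w √d)(x + y √d), where u + w √d is the unit
-- a + √d if b = 1 and 2a²b − 1 + 2a √d if b > 1.  Hence the listed finite
-- continued fractions are the powers of that unit.  Moreover x² − d y² takes
-- only finitely many values along the convergents while y grows without
-- bound, so the convergents tend to √d.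

open import Defs
open import Data.Fin using (toℕ)
open import Data.Fin.Properties using (toℕ-fromℕ<; toℕ-injective)
import Data.Integer as ℤ
import Data.Integer.Properties as ℤ
import Data.Integer.Tactic.RingSolver as ℤ
open import Data.List using (List; []; _∷_; _++_; applyUpTo)
open import Data.List.Properties using (++-assoc)
open import Data.List.Relation.Unary.All using (All; []; _∷_)
import Data.List.Relation.Unary.All.Properties as All
open import Data.Nat using (ℕ; zero; suc; _+_; _*_; _∸_; _^_; _≤_; _<_; z≤n; s≤s; z<s; >-nonZero)
open import Data.Nat.DivMod using (_mod_; _%_; [m+n]%n≡m%n)
open import Data.Nat.Induction using (<-rec)
open import Data.Nat.Properties
open import Data.Nat.Tactic.RingSolver using (solve-∀)
open import Data.Product using (∃-syntax; _×_; _,_; proj₁; proj₂)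
import Data.Rational.Unnormalised as ℚ
import Data.Rational.Unnormalised.Properties as ℚ
open import Data.Rational.Unnormalised using (ℚᵘ; mkℚᵘ; *≡*; *<*; _≃_)
open import Data.Sum using (inj₁; inj₂)
open import Data.Vec using (Vec; []; _∷_; lookup)
import Data.Vec.Relation.Unary.All as Vec
import Data.Vec.Relation.Unary.All.Properties as Vec
open Vec.All
open import Function using (_∘_)
open import Relation.Binary.PropositionalEquality
open import Relation.Nullary using (¬_)

-- Finite continued fractions as quotients of continuants

-- The value [ a ⨾ bs ] is num a bs / den bs, which is affine in the head a.
-- The junk value rem [] = 0 makes the formula for num cover bs = [].
den rem : List ℕ → ℕ
den []       = 1
den (b ∷ bs) = b * den bs + rem bs
rem []       = 0
rem (b ∷ bs) = den bs

num : ℕ → List ℕ → ℕ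
num a bs = a * den bs + rem bs

den-positive : ∀ {bs} → All (1 ≤_) bs → 1 ≤ den bs
den-positive []           = ≤-refl
den-positive {b ∷ bs} (1≤b ∷ 1≤bs) =
  ≤-trans (*-mono-≤ 1≤b (den-positive 1≤bs)) (m≤m+n (b * den bs) (rem bs))

num-positive : ∀ {a bs} → 1 ≤ a → All (1 ≤_) bs → 1 ≤ num a bs
num-positive 1≤a 1≤bs = den-positive (1≤a ∷ 1≤bs)

-- A value equal to a positive fraction cannot have a zero or negative numerator, so the default
-- value of `recip` at 0 is never reached.
recip-ratio : ∀ {q} p r → q ≃ mkℚᵘ ℤ.+[1+ p ] r → recip q ≃ mkℚᵘ ℤ.+[1+ r ] p
recip-ratio {mkℚᵘ (ℤ.+ zero)  _} p r (*≡* ())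
recip-ratio {mkℚᵘ ℤ.-[1+ _ ]  _} p r (*≡* ())
recip-ratio {mkℚᵘ ℤ.+[1+ n ]  s} p r (*≡* eq) =
  *≡* (trans (ℤ.*-comm ℤ.+[1+ s ] ℤ.+[1+ p ]) (trans (sym eq) (ℤ.*-comm ℤ.+[1+ n ] ℤ.+[1+ r ])))

fromℕ-+ : ∀ a r p → mkℚᵘ (ℤ.+ (a * suc p + r)) p ≃ fromℕ a ℚ.+ mkℚᵘ (ℤ.+ r) p
fromℕ-+ a r p = ℚ.≃-reflexive (cong₂ mkℚᵘ numerators (sym (+-identityʳ p)))
  where
  numerators : ℤ.+ (a * suc p + r) ≡ ℤ.+ a ℤ.* ℤ.+ suc p ℤ.+ ℤ.+ r ℤ.* ℤ.1ℤ
  numerators = trans (ℤ.pos-+ (a * suc p) r)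
    (cong₂ ℤ._+_ (ℤ.pos-* a (suc p)) (sym (ℤ.*-identityʳ (ℤ.+ r))))

+-recip-ratio : ∀ a {p r q} → 1 ≤ p → 1 ≤ r → RatioIs p r q →
  RatioIs (a * p + r) p (fromℕ a ℚ.+ recip q)
+-recip-ratio a {suc p} {suc r} _ _ (_ , eq) = _ ,
  ℚ.≃-trans (fromℕ-+ a (suc r) p) (ℚ.+-congʳ (fromℕ a) (ℚ.≃-sym (recip-ratio p r (ℚ.≃-sym eq))))

-- The fraction with head `b` has numerator `num b bs`, which is `den (b ∷ bs)` by definition.
-- Inverting it therefore gives `den bs` over `den (b ∷ bs)`, and positive quotients keep both
-- nonzero.
[⨾]-ratio : ∀ a {bs} → All (1 ≤_) bs → RatioIs (num a bs) (den bs) [ a ⨾ bs ]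
[⨾]-ratio a [] = _ , ℚ.≃-reflexive (cong fromℕ (trans (+-identityʳ (a * 1)) (*-identityʳ a)))
[⨾]-ratio a {b ∷ bs} (1≤b ∷ 1≤bs) =
  +-recip-ratio a (den-positive (1≤b ∷ 1≤bs)) (den-positive 1≤bs) ([⨾]-ratio b 1≤bs)

-- Blocks of partial quotients and units u + w √d

-- Quantifying over every `bs` lets one identity serve both the finite fractions with a prescribed
-- ending and all truncations of the periodic expansion.
Turns : (d u w M : ℕ) → List ℕ → Set
Turns d u w M block = ∀ bs →
  (num M (block ++ bs) , den (block ++ bs)) ≡ surdMul d (u , w) (num M bs , den bs)

-- The tail already contributes one factor u + w √d, so n blocks in front of it give the power n +
-- 1. This accounts for `n ∸ 1` blocks in the n-th solution.
turns-⟨×⟩ : ∀ {d u w M block tail} → Turns d u w M block →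
  num M tail ≡ u → den tail ≡ w → ∀ n →
  (num M (block ⟨× n ⟩ ++ tail) , den (block ⟨× n ⟩ ++ tail)) ≡ surdPow d (u , w) (suc n)
turns-⟨×⟩ {d} {u} {w} turns num≡u den≡w zero =
  cong₂ _,_ (trans num≡u (first u d w)) (trans den≡w (second u w))
  where
  first : ∀ u d w → u ≡ u * 1 + d * (w * 0)
  first = solve-∀
  second : ∀ u w → w ≡ u * 0 + w * 1
  second = solve-∀
turns-⟨×⟩ {d} {u} {w} {M} {block} {tail} turns num≡u den≡w (suc n) = begin
  (num M ((block ++ block ⟨× n ⟩) ++ tail) , den ((block ++ block ⟨× n ⟩) ++ tail))
    ≡⟨ cong (λ l → num M l , den l) (++-assoc block (block ⟨× n ⟩) tail) ⟩
  (num M (block ++ block ⟨× n ⟩ ++ tail) , den (block ++ block ⟨× n ⟩ ++ tail))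
    ≡⟨ turns (block ⟨× n ⟩ ++ tail) ⟩
  surdMul d (u , w) (num M (block ⟨× n ⟩ ++ tail) , den (block ⟨× n ⟩ ++ tail))
    ≡⟨ cong (surdMul d (u , w)) (turns-⟨×⟩ {M = M} {block} {tail} turns num≡u den≡w n) ⟩
  surdPow d (u , w) (suc (suc n)) ∎
  where open ≡-Reasoning

-- Rational approximations to √d

square-< : ∀ {t n d} → t * t < d * (suc n * suc n) →
  mkℚᵘ (ℤ.+ t) n ℚ.* mkℚᵘ (ℤ.+ t) n ℚ.< fromℕ d
square-< {t} {n} {d} lt = *<* (subst₂ ℤ._<_
  (trans (ℤ.pos-* t t) (sym (ℤ.*-identityʳ _))) (ℤ.pos-* d (suc n * suc n)) (ℤ.+<+ lt))

square-> : ∀ {t n d} → d * (suc n * suc n) < t * t →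
  fromℕ d ℚ.< mkℚᵘ (ℤ.+ t) n ℚ.* mkℚᵘ (ℤ.+ t) n
square-> {t} {n} {d} lt = *<* (subst₂ ℤ._<_
  (ℤ.pos-* d (suc n * suc n)) (trans (ℤ.pos-* t t) (sym (ℤ.*-identityʳ _))) (ℤ.+<+ lt))

<√-resp-≃ : ∀ {d p q} → p ≃ q → p <√ d → q <√ d
<√-resp-≃ p≃q (inj₁ p<0)  = inj₁ (ℚ.<-respˡ-≃ p≃q p<0)
<√-resp-≃ p≃q (inj₂ pp<d) = inj₂ (ℚ.<-respˡ-≃ (ℚ.*-cong p≃q p≃q) pp<d)

√<-resp-≃ : ∀ {d p q} → p ≃ q → √ d < p → √ d < q
√<-resp-≃ p≃q (0<p , d<pp) = ℚ.<-respʳ-≃ p≃q 0<p , ℚ.<-respʳ-≃ (ℚ.*-cong p≃q p≃q) d<pp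

-- The bound |x² - d y²| ≤ C, split into two inequalities free of subtraction.
record NormBound (d C x y : ℕ) : Set where
  field
    above : x * x ≤ d * (y * y) + C
    below : d * (y * y) ≤ x * x + C

-- The norm bound puts (x / n)² within C / n² of d, where n = `suc y`. Since the tolerance is at
-- least 1 / `suc D`, a threshold for n that ignores `e` suffices.
module _ {d C x y e D : ℕ} (norm : NormBound d C x (suc y)) (1≤x : 1 ≤ x) (large : C * suc D < suc y) where
  open NormBound norm

  private
    n ε δ : ℕ
    n = suc y
    ε = suc e
    δ = suc D
    -- The cross term of (x / n ± ε / δ)² exceeds the defect C / n² of (x / n)² from d.
    slack : C * (δ * δ) < (x * δ) * (ε * n)
    slack = begin-strict
      C * (δ * δ)             ≡⟨ *-assoc C δ δ ⟨
      C * δ * δ               <⟨ *-monoˡ-< δ large ⟩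
      n * δ                   ≡⟨ one n δ ⟩
      (1 * δ) * (1 * n)       ≤⟨ *-mono-≤ (*-monoˡ-≤ δ 1≤x) (*-monoˡ-≤ n {1} {ε} (s≤s z≤n)) ⟩
      (x * δ) * (ε * n)       ∎
      where
      open ≤-Reasoning
      one : ∀ n δ → n * δ ≡ (1 * δ) * (1 * n)
      one = solve-∀

  √<+ : √ d < mkℚᵘ (ℤ.+ x) y ℚ.+ mkℚᵘ (ℤ.+ suc e) D
  √<+ = √<-resp-≃ {d} {mkℚᵘ (ℤ.+ (x * δ + ε * n)) _} (ℚ.≃-reflexive (cong (λ i → mkℚᵘ i _)
      (trans (ℤ.pos-+ (x * δ) (ε * n)) (cong₂ ℤ._+_ (ℤ.pos-* x δ) (ℤ.pos-* ε n)))))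
    (*<* (subst (ℤ.0ℤ ℤ.<_) (sym (ℤ.*-identityʳ _)) (ℤ.+<+ (<-≤-trans (*-mono-≤ 1≤x (s≤s z≤n)) (m≤m+n (x * δ) (ε * n)))))
    , square-> {x * δ + ε * n} {D + y * δ} {d} (begin-strict
      d * ((n * δ) * (n * δ))                        ≡⟨ expandˡ d n δ ⟩
      d * (n * n) * (δ * δ)                          ≤⟨ *-monoˡ-≤ (δ * δ) below ⟩
      (x * x + C) * (δ * δ)                          ≡⟨ *-distribʳ-+ (δ * δ) (x * x) C ⟩
      x * x * (δ * δ) + C * (δ * δ)                  <⟨ +-monoʳ-< (x * x * (δ * δ)) slack ⟩
      x * x * (δ * δ) + (x * δ) * (ε * n)            ≤⟨ m≤m+n _ _ ⟩
      x * x * (δ * δ) + (x * δ) * (ε * n) + ((x * δ) * (ε * n) + (ε * n) * (ε * n))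
        ≡⟨ expandʳ x δ (ε * n) ⟩
      (x * δ + ε * n) * (x * δ + ε * n)              ∎))
    where
    open ≤-Reasoning
    expandˡ : ∀ d n δ → d * ((n * δ) * (n * δ)) ≡ d * (n * n) * (δ * δ)
    expandˡ = solve-∀
    expandʳ : ∀ x δ s → x * x * (δ * δ) + (x * δ) * s + ((x * δ) * s + s * s) ≡ (x * δ + s) * (x * δ + s)
    expandʳ = solve-∀

  -<√ : mkℚᵘ (ℤ.+ x) y ℚ.- mkℚᵘ (ℤ.+ suc e) D <√ d
  -<√ with <-≤-connex (x * δ) (ε * n)
  -- Here the difference is negative and lies in the lower cut without any squaring. In the other
  -- case the truncated subtraction defining `t` is exact.
  ... | inj₁ xδ<εn = inj₁ (ℚ.<-respʳ-≃ (ℚ.+-inverseʳ ε/δ) (ℚ.+-monoˡ-< (ℚ.- ε/δ) {mkℚᵘ (ℤ.+ x) y} {ε/δ}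
      (*<* (subst₂ ℤ._<_ (ℤ.pos-* x δ) (ℤ.pos-* ε n) (ℤ.+<+ xδ<εn)))))
    where
    ε/δ : ℚᵘ
    ε/δ = mkℚᵘ (ℤ.+ ε) D
  ... | inj₂ εn≤xδ = <√-resp-≃ {d} {mkℚᵘ (ℤ.+ t) _} (ℚ.≃-reflexive (cong (λ i → mkℚᵘ i _) (sym difference)))
      (inj₂ (square-< {t} {D + y * δ} {d} (+-cancelʳ-< ((x * δ) * (ε * n)) _ _ (begin-strict
      t * t + (x * δ) * (ε * n)                      ≤⟨ bound ⟩
      (x * δ) * (x * δ)                              ≡⟨ square-* x δ ⟩
      x * x * (δ * δ)                                ≤⟨ *-monoˡ-≤ (δ * δ) above ⟩
      (d * (n * n) + C) * (δ * δ)                    ≡⟨ *-distribʳ-+ (δ * δ) (d * (n * n)) C ⟩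
      d * (n * n) * (δ * δ) + C * (δ * δ)            <⟨ +-monoʳ-< (d * (n * n) * (δ * δ)) slack ⟩
      d * (n * n) * (δ * δ) + (x * δ) * (ε * n)      ≡⟨ cong (_+ (x * δ) * (ε * n)) (expand d n δ) ⟩
      d * ((n * δ) * (n * δ)) + (x * δ) * (ε * n)    ∎))))
    where
    open ≤-Reasoning
    t : ℕ
    t = x * δ ∸ ε * n
    difference : ℤ.+ x ℤ.* ℤ.+ δ ℤ.+ ℤ.-[1+ e ] ℤ.* ℤ.+ n ≡ ℤ.+ t
    difference = trans (cong₂ ℤ._+_ (sym (ℤ.pos-* x δ))
        (trans (sym (ℤ.neg-distribˡ-* (ℤ.+ ε) (ℤ.+ n))) (cong ℤ.-_ (sym (ℤ.pos-* ε n)))))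
      (trans (ℤ.m-n≡m⊖n (x * δ) (ε * n)) (ℤ.⊖-≥ εn≤xδ))
    square-* : ∀ x δ → (x * δ) * (x * δ) ≡ x * x * (δ * δ)
    square-* = solve-∀
    expand : ∀ d n δ → d * (n * n) * (δ * δ) ≡ d * ((n * δ) * (n * δ))
    expand = solve-∀
    identity : ∀ t s → t * t + (t + s) * s + t * s ≡ (t + s) * (t + s)
    identity = solve-∀
    -- With s = ε n and t + s = x δ, the square (t + s)² exceeds t² by (t + s) s + t s, so one full
    -- cross term fits in the gap.
    bound : t * t + (x * δ) * (ε * n) ≤ (x * δ) * (x * δ)
    bound = subst (λ z → t * t + z * (ε * n) ≤ z * z) (m∸n+n≡m εn≤xδ)
      (≤-trans (m≤m+n _ _) (≤-reflexive (identity t (ε * n))))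

-- The norm is multiplicative and u + w √d has norm 1. Both norms are rearranged so that no
-- subtraction occurs.
surdMul-norm : ∀ {d u w} → u * u ≡ 1 + d * (w * w) → ∀ x y →
  let (x′ , y′) = surdMul d (u , w) (x , y) in
  x′ * x′ + d * (y * y) ≡ d * (y′ * y′) + x * x
surdMul-norm {d} {u} {w} unit x y = +-cancelʳ-≡ rest _ _ (begin
  X + d * (y * y) + rest
    ≡⟨ lemma₁ d u w x y ⟩
  Y + (u * u * (x * x) + d * (w * w) * (d * (y * y)) + d * (y * y))
    ≡⟨ cong (λ z → Y + (z * (x * x) + d * (w * w) * (d * (y * y)) + d * (y * y))) unit ⟩
  Y + ((1 + d * (w * w)) * (x * x) + d * (w * w) * (d * (y * y)) + d * (y * y))
    ≡⟨ lemma₂ Y (d * (w * w)) x (d * (y * y)) ⟩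
  Y + x * x + (d * (y * y) * (1 + d * (w * w)) + d * (w * w) * (x * x))
    ≡⟨ cong (λ z → Y + x * x + (d * (y * y) * z + d * (w * w) * (x * x))) unit ⟨
  Y + x * x + rest ∎)
  where
  open ≡-Reasoning
  X Y rest : ℕ
  X = (u * x + d * (w * y)) * (u * x + d * (w * y))
  Y = d * ((u * y + w * x) * (u * y + w * x))
  -- These are the two negative terms of (u² - d w²)(x² - d y²). Adding them to both sides makes the
  -- expansion an identity in ℕ.
  rest = d * (y * y) * (u * u) + d * (w * w) * (x * x)
  lemma₁ : ∀ d u w x y →
    (u * x + d * (w * y)) * (u * x + d * (w * y)) + d * (y * y) + (d * (y * y) * (u * u) + d * (w * w) * (x * x))
    ≡ d * ((u * y + w * x) * (u * y + w * x)) + (u * u * (x * x) + d * (w * w) * (d * (y * y)) + d * (y * y))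
  lemma₁ = solve-∀
  lemma₂ : ∀ Y W x z → Y + ((1 + W) * (x * x) + W * z + z) ≡ Y + x * x + (z * (1 + W) + W * (x * x))
  lemma₂ = solve-∀

surdMul-normBound : ∀ {d u w C x y} → u * u ≡ 1 + d * (w * w) → NormBound d C x y →
  let (x′ , y′) = surdMul d (u , w) (x , y) in NormBound d C x′ y′
surdMul-normBound {d} {u} {w} {C} {x} {y} unit norm = record
  { above = +-cancelʳ-≤ (d * (y * y)) _ _ (begin
      X + d * (y * y)            ≡⟨ surdMul-norm {d} {u} {w} unit x y ⟩
      Y + x * x                  ≤⟨ +-monoʳ-≤ Y above ⟩
      Y + (d * (y * y) + C)      ≡⟨ swap Y (d * (y * y)) C ⟩
      Y + C + d * (y * y)        ∎)
  ; below = +-cancelʳ-≤ (x * x) _ _ (begin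
      Y + x * x                  ≡⟨ surdMul-norm {d} {u} {w} unit x y ⟨
      X + d * (y * y)            ≤⟨ +-monoʳ-≤ X below ⟩
      X + (x * x + C)            ≡⟨ swap X (x * x) C ⟩
      X + C + x * x              ∎)
  }
  where
  open NormBound norm
  open ≤-Reasoning
  X Y : ℕ
  X = (u * x + d * (w * y)) * (u * x + d * (w * y))
  Y = d * ((u * y + w * x) * (u * y + w * x))
  swap : ∀ m n o → m + (n + o) ≡ m + o + n
  swap = solve-∀

-- Purely periodic tails

lookup-mod-periodic : ∀ {m} (v : Vec ℕ (suc m)) k → lookup v ((suc m + k) mod suc m) ≡ lookup v (k mod suc m)
lookup-mod-periodic {m} v k = cong (lookup v) (toℕ-injective (begin
  toℕ ((suc m + k) mod suc m)  ≡⟨ toℕ-fromℕ< _ ⟩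
  (suc m + k) % suc m          ≡⟨ cong (_% suc m) (+-comm (suc m) k) ⟩
  (k + suc m) % suc m          ≡⟨ [m+n]%n≡m%n k (suc m) ⟩
  k % suc m                    ≡⟨ toℕ-fromℕ< _ ⟨
  toℕ (k mod suc m)            ∎))
  where open ≡-Reasoning

applyUpTo-cong : ∀ {f g : ℕ → ℕ} → (∀ i → f i ≡ g i) → ∀ n → applyUpTo f n ≡ applyUpTo g n
applyUpTo-cong f≗g zero    = refl
applyUpTo-cong f≗g (suc n) = cong₂ _∷_ (f≗g 0) (applyUpTo-cong (f≗g ∘ suc) n)

applyUpTo-+ : ∀ (f : ℕ → ℕ) m n → applyUpTo f (m + n) ≡ applyUpTo f m ++ applyUpTo (f ∘ (m +_)) n
applyUpTo-+ f zero    n = refl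
applyUpTo-+ f (suc m) n = cong (f 0 ∷_) (applyUpTo-+ (f ∘ suc) m n)

periodic-induction : ∀ {P : ℕ → Set} m → (∀ k → k < suc m → P k) → (∀ k → P k → P (suc m + k)) → ∀ k → P k
periodic-induction {P} m base step = <-rec P go
  where
  go : ∀ k → (∀ {j} → j < k → P j) → P k
  go k rec with <-≤-connex k (suc m)
  ... | inj₁ k<1+m = base k k<1+m
  ... | inj₂ 1+m≤k = subst P (m+[n∸m]≡n 1+m≤k)
    (step (k ∸ suc m) (rec (∸-monoʳ-< {k} z<s 1+m≤k)))

bounded-initially : ∀ (f : ℕ → ℕ) n → ∃[ C ] ∀ k → k < n → f k ≤ C
bounded-initially f zero    = 0 , λ _ ()
bounded-initially f (suc n) with C , f≤C ← bounded-initially f n = C + f n , bound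
  where
  bound : ∀ k → k < suc n → f k ≤ C + f n
  bound k k<1+n with m<1+n⇒m<n∨m≡n k<1+n
  ... | inj₁ k<n  = ≤-trans (f≤C k k<n) (m≤m+n C (f n))
  ... | inj₂ refl = m≤n+m (f n) C

module _ {m} {d u w M} (v : Vec ℕ (suc m)) (1≤M : 1 ≤ M) (1≤v : Vec.All (1 ≤_) v)
  (unit : u * u ≡ 1 + d * (w * w)) (1≤u : 1 ≤ u) (1≤w : 1 ≤ w)
  (turns : Turns d u w M (applyUpTo (λ i → lookup v (i mod suc m)) (suc m)))
  where

  private
    v-positive : ∀ i → 1 ≤ lookup v i
    v-positive = Vec.lookup⁺ 1≤v

    tail : ℕ → List ℕ
    tail = applyUpTo (λ i → lookup v (i mod suc m))

    tail-positive : ∀ k → All (1 ≤_) (tail k)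
    tail-positive k = All.applyUpTo⁺₂ _ k (λ i → v-positive (i mod suc m))

    tail-turn : ∀ k → (num M (tail (suc m + k)) , den (tail (suc m + k)))
                    ≡ surdMul d (u , w) (num M (tail k) , den (tail k))
    tail-turn k = trans (cong (λ l → num M l , den l)
        (trans (applyUpTo-+ (λ i → lookup v (i mod suc m)) (suc m) k)
          (cong (tail (suc m) ++_) (applyUpTo-cong (lookup-mod-periodic v) k))))
      (turns (tail k))

    -- The sum of the two terms dominates their difference in either direction. A bound over the
    -- first period is enough, because each further period preserves the norm.
    norm-bounded : ∃[ C ] ∀ k → k < suc m →
      num M (tail k) * num M (tail k) + d * (den (tail k) * den (tail k)) ≤ C
    norm-bounded = bounded-initially _ (suc m)

    C : ℕ
    C = proj₁ norm-bounded

    normBound : ∀ k → NormBound d C (num M (tail k)) (den (tail k))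
    normBound = periodic-induction m
      (λ k k<1+m → let bound = proj₂ norm-bounded k k<1+m in record
        { above = ≤-trans (m+n≤o⇒m≤o _ bound) (m≤n+m C (d * (den (tail k) * den (tail k))))
        ; below = ≤-trans (m+n≤o⇒n≤o (num M (tail k) * num M (tail k)) bound) (m≤n+m C (num M (tail k) * num M (tail k))) })
      (λ k norm → subst (λ (x , y) → NormBound d C x y) (sym (tail-turn k))
        (surdMul-normBound {u = u} {w} unit norm))

    -- A period sends the denominator y to u y + w x ≥ y + 1, so denominators grow at least linearly
    -- in the number of periods.
    den-grows : ∀ k → k < suc m * den (tail k)
    den-grows = periodic-induction m
      (λ k k<1+m → ≤-trans k<1+m (m≤m*n (suc m) _ ⦃ >-nonZero (den-positive (tail-positive k)) ⦄))
      (λ k k<den → begin-strict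
        suc m + k                           <⟨ +-monoʳ-< (suc m) k<den ⟩
        suc m + suc m * den (tail k)        ≡⟨ *-suc (suc m) (den (tail k)) ⟨
        suc m * (1 + den (tail k))          ≤⟨ *-monoʳ-≤ (suc m) (begin
          1 + den (tail k)                                  ≡⟨ trans (+-comm 1 _) (cong (_+ 1) (sym (*-identityˡ _))) ⟩
          1 * den (tail k) + 1 * 1
            ≤⟨ +-mono-≤ (*-monoˡ-≤ (den (tail k)) 1≤u) (*-mono-≤ 1≤w (num-positive {M} 1≤M (tail-positive k))) ⟩
          u * den (tail k) + w * num M (tail k)             ≡⟨ cong proj₂ (tail-turn k) ⟨
          den (tail (suc m + k))                            ∎) ⟩
        suc m * den (tail (suc m + k))      ∎)
      where open ≤-Reasoning

  √-expansion : √ d HasExpansion [ M ⨾‾ v ]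
  √-expansion = record
    { quotients-positive = λ k → v-positive (k mod suc m)
    ; converges          = converges
    }
    where
    converges : convergent [ M ⨾‾ v ] ConvergesTo√ d
    converges (mkℚᵘ ℤ.+0 _) (*<* (ℤ.+<+ ()))
    converges (mkℚᵘ ℤ.-[1+ _ ] _) (*<* ())
    -- Cancelling the factor `suc m` from `den-grows` turns this threshold into C · `suc D` <
    -- `den (tail k)`, the size that the approximation estimates require.
    converges ε@(mkℚᵘ ℤ.+[1+ e ] D) _ = suc m * (C * suc D) , λ k N≤k →
      close (normBound k) (num-positive {M} 1≤M (tail-positive k))
        (*-cancelˡ-< (suc m) _ _ (≤-<-trans N≤k (den-grows k))) ([⨾]-ratio M (tail-positive k))
      where
      close : ∀ {x y s} → NormBound d C x y → 1 ≤ x → C * suc D < y → RatioIs x y s →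
        (s ℚ.- ε <√ d) × (√ d < s ℚ.+ ε)
      close {y = suc y} norm 1≤x large (_ , eq) =
        <√-resp-≃ {d} (ℚ.+-congˡ (ℚ.- ε) eq) (-<√ {e = e} norm 1≤x large) ,
        √<-resp-≃ {d} (ℚ.+-congˡ ε eq) (√<+ {e = e} norm 1≤x large)

-- Fundamental solutions

m^2≡m*m : ∀ m → m ^ 2 ≡ m * m
m^2≡m*m m = cong (m *_) (*-identityʳ m)

module _ {d x y : ℕ} where

  equation⇒ : IsPositiveSolution d x y → x * x ≡ 1 + d * (y * y)
  equation⇒ solution = ℤ.+-injective (begin
    ℤ.+ (x * x)                                 ≡⟨ cong ℤ.+_ (m^2≡m*m x) ⟨
    ℤ.+ (x ^ 2)                                 ≡⟨ cancel (ℤ.+ (x ^ 2)) (ℤ.+ (d * y ^ 2)) ⟩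
    ℤ.+ (x ^ 2) ℤ.- ℤ.+ (d * y ^ 2) ℤ.+ ℤ.+ (d * y ^ 2)
                                                ≡⟨ cong₂ ℤ._+_ equation (cong (λ s → ℤ.+ (d * s)) (m^2≡m*m y)) ⟩
    ℤ.+ (1 + d * (y * y))                       ∎)
    where
    open IsPositiveSolution solution
    open ≡-Reasoning
    cancel : ∀ i j → i ≡ i ℤ.- j ℤ.+ j
    cancel = ℤ.solve-∀

  ⇒solution : 1 ≤ x → 1 ≤ y → x * x ≡ 1 + d * (y * y) → IsPositiveSolution d x y
  ⇒solution 1≤x 1≤y eq = record
    { x-positive = 1≤x
    ; y-positive = 1≤y
    ; equation   = begin
        ℤ.+ (x ^ 2) ℤ.- ℤ.+ (d * y ^ 2)
          ≡⟨ cong₂ (λ s t → ℤ.+ s ℤ.- ℤ.+ (d * t)) (trans (m^2≡m*m x) eq) (m^2≡m*m y) ⟩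
        ℤ.1ℤ ℤ.+ ℤ.+ (d * (y * y)) ℤ.- ℤ.+ (d * (y * y))
          ≡⟨ cancel ℤ.1ℤ (ℤ.+ (d * (y * y))) ⟩
        ℤ.1ℤ ∎
    }
    where
    open ≡-Reasoning
    cancel : ∀ i j → i ℤ.+ j ℤ.- j ≡ i
    cancel = ℤ.solve-∀

*-self-cancel-≤ : ∀ m n → m * m ≤ n * n → m ≤ n
*-self-cancel-≤ m n mm≤nn = ≮⇒≥ λ n<m → <⇒≱ (*-mono-< n<m n<m) mm≤nn

-- Since x² = 1 + d y² is monotone in y, minimality of the second coordinate carries over to the
-- first.
isFundamental : ∀ {d u w} → 1 ≤ u → 1 ≤ w → u * u ≡ 1 + d * (w * w) →
  (∀ {x y} → 1 ≤ y → x * x ≡ 1 + d * (y * y) → w ≤ y) → IsFundamental d u w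
isFundamental {d} {u} {w} 1≤u 1≤w unit least = record
  { solution = ⇒solution 1≤u 1≤w unit
  ; smallest = λ x y solution →
      let eq  = equation⇒ solution
          w≤y = least {x} (IsPositiveSolution.y-positive solution) eq
      in *-self-cancel-≤ u x (subst₂ _≤_ (sym unit) (sym eq) (s≤s (*-monoʳ-≤ d (*-mono-≤ w≤y w≤y)))) , w≤y
  }

fundamental-unique : ∀ {d x y u w} → IsFundamental d x y → IsFundamental d u w → (x , y) ≡ (u , w)
fundamental-unique f g = cong₂ _,_
  (≤-antisym (proj₁ (f.smallest _ _ g.solution)) (proj₁ (g.smallest _ _ f.solution)))
  (≤-antisym (proj₂ (f.smallest _ _ g.solution)) (proj₂ (g.smallest _ _ f.solution)))
  where
  module f = IsFundamental f
  module g = IsFundamental g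

-- `IsNthSolution` only asserts that some fundamental solution exists. Uniqueness identifies it with
-- (u, w), whose powers are the listed fractions.
nthSolution-ratio : ∀ {d u w M block tail} → IsFundamental d u w → Turns d u w M block →
  All (1 ≤_) block → All (1 ≤_) tail → num M tail ≡ u → den tail ≡ w →
  ∀ n x y → 1 ≤ n → IsNthSolution d n x y → RatioIs x y [ M ⨾ block ⟨× n ∸ 1 ⟩ ++ tail ]
nthSolution-ratio {d} {u} {w} {M} {block} {tail} fundamental turns 1≤block 1≤tail num≡u den≡w
  (suc n) x y _ (x₁ , y₁ , fundamental₁ , xy≡) =
  subst (λ (x , y) → RatioIs x y [ M ⨾ block ⟨× n ⟩ ++ tail ]) (sym (begin
    (x , y)                            ≡⟨ xy≡ ⟩
    surdPow d (x₁ , y₁) (suc n)        ≡⟨ cong (λ z → surdPow d z (suc n)) (fundamental-unique fundamental₁ fundamental) ⟩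
    surdPow d (u , w) (suc n)          ≡⟨ turns-⟨×⟩ {d} {u} {w} {M} {block} {tail} turns num≡u den≡w n ⟨
    (num M (block ⟨× n ⟩ ++ tail) , den (block ⟨× n ⟩ ++ tail)) ∎))
  ([⨾]-ratio M (All.++⁺ (All.concat⁺ (All.replicate⁺ n 1≤block)) 1≤tail))
  where open ≡-Reasoning

-- With A = a b, writing A y = x + t turns the equation into
-- b y² = 1 + 2 x t + t²; together with b y (y + 1) ≤ 2 (x + t) this contradicts (t − 1)² ≥ 0.
least-denominator : ∀ {a b d x y} → 1 < b → d + b ≡ (a * b) * (a * b) → 1 ≤ y →
  x * x ≡ 1 + d * (y * y) → 2 * a ≤ y
least-denominator {a} {b} {d} {x} {y} 1<b d+b 1≤y eq = ≮⇒≥ contradict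
  where
  open ≤-Reasoning
  A : ℕ
  A = a * b
  square : ∀ A y → A * A * (y * y) ≡ (A * y) * (A * y)
  square = solve-∀
  norm : x * x + b * (y * y) ≡ 1 + (A * y) * (A * y)
  norm = begin-equality
    x * x + b * (y * y)                  ≡⟨ cong (_+ b * (y * y)) eq ⟩
    1 + (d * (y * y) + b * (y * y))      ≡⟨ cong suc (*-distribʳ-+ (y * y) d b) ⟨
    1 + (d + b) * (y * y)                ≡⟨ cong (λ z → 1 + z * (y * y)) d+b ⟩
    1 + A * A * (y * y)                  ≡⟨ cong suc (square A y) ⟩
    1 + (A * y) * (A * y)                ∎
  -- If A y ≤ x, the norm equation would leave b y² ≤ 1, which b > 1 and y ≥ 1 exclude.
  x<Ay : x < A * y
  x<Ay = ≰⇒> λ Ay≤x → <⇒≱ (*-mono-≤ 1<b (*-mono-≤ 1≤y 1≤y)) (+-cancelˡ-≤ (x * x) _ _ (begin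
    x * x + b * (y * y)                  ≡⟨ norm ⟩
    1 + (A * y) * (A * y)                ≤⟨ s≤s (*-mono-≤ Ay≤x Ay≤x) ⟩
    1 + x * x                            ≡⟨ +-comm 1 (x * x) ⟩
    x * x + 1                            ∎))
  -- This is t - 1, so t ≥ 1 is built in and (t - 1)² becomes `s * s`.
  s : ℕ
  s = A * y ∸ suc x
  x+t : x + suc s ≡ A * y
  x+t = trans (+-suc x s) (m+[n∸m]≡n x<Ay)
  contradict : ¬ (y < 2 * a)
  -- Dropping the nonnegative terms 2 x s + s² and cancelling 2 (x + t) leaves b y ≤ 0.
  contradict y<2a = <⇒≱ (*-mono-≤ (<⇒≤ 1<b) 1≤y) (+-cancelˡ-≤ (2 * (x + suc s)) _ _ (begin
    2 * (x + suc s) + b * y                              ≤⟨ +-monoˡ-≤ (b * y) (m≤m+n _ (2 * x * s + s * s)) ⟩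
    2 * (x + suc s) + (2 * x * s + s * s) + b * y        ≡⟨ cong (_+ b * y) (complete x s) ⟩
    1 + (2 * x * suc s + suc s * suc s) + b * y          ≡⟨ cong (_+ b * y) by² ⟨
    b * (y * y) + b * y                                  ≡⟨ collect b y ⟩
    b * y * (1 + y)                                      ≤⟨ *-monoʳ-≤ (b * y) y<2a ⟩
    b * y * (2 * a)                                      ≡⟨ rearrange a b y ⟩
    2 * (A * y)                                          ≡⟨ cong (2 *_) x+t ⟨
    2 * (x + suc s)                                      ≡⟨ +-identityʳ _ ⟨
    2 * (x + suc s) + 0                                  ∎))
    where
    complete : ∀ x s → 2 * (x + suc s) + (2 * x * s + s * s) ≡ 1 + (2 * x * suc s + suc s * suc s)
    complete = solve-∀
    collect : ∀ b y → b * (y * y) + b * y ≡ b * y * (1 + y)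
    collect = solve-∀
    rearrange : ∀ a b y → b * y * (2 * a) ≡ 2 * ((a * b) * y)
    rearrange = solve-∀
    expand : ∀ x t → 1 + (x + t) * (x + t) ≡ x * x + (1 + (2 * x * t + t * t))
    expand = solve-∀
    by² : b * (y * y) ≡ 1 + (2 * x * suc s + suc s * suc s)
    by² = +-cancelˡ-≡ (x * x) _ _ (begin-equality
      x * x + b * (y * y)                      ≡⟨ norm ⟩
      1 + (A * y) * (A * y)                    ≡⟨ cong (λ z → 1 + z * z) x+t ⟨
      1 + (x + suc s) * (x + suc s)            ≡⟨ expand x (suc s) ⟩
      x * x + (1 + (2 * x * suc s + suc s * suc s)) ∎)

-- The family a²b² − b, with a = 1 + α and b = 1 + β

-- The factorisation d = b (a²b - 1). The second factor is written without subtraction as (a - 1) +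
-- a (ab - 1), where ab - 1 is `β + α * suc β`.
disc≡ : ∀ α β → disc (suc α) (suc β) ≡ suc β * (α + suc α * (β + α * suc β))
disc≡ α β = trans
  (cong (_∸ suc β) (trans (cong₂ _*_ (m^2≡m*m (suc α)) (m^2≡m*m (suc β))) (polynomial α β)))
  (m+n∸n≡m _ (suc β))
  where
  polynomial : ∀ α β → suc α * suc α * (suc β * suc β) ≡ suc β * (α + suc α * (β + α * suc β)) + suc β
  polynomial = solve-∀

2*1+n∸2≡2*n : ∀ n → 2 * suc n ∸ 2 ≡ 2 * n
2*1+n∸2≡2*n n = sym (*-distribˡ-∸ 2 (suc n) 1)

-- The case b = 1, with unit a + √d

module B≡1 (α : ℕ) (1≤α : 1 ≤ α) where

  a d P : ℕ
  a = suc α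
  d = disc a 1
  P = 2 * a ∸ 2

  d≡ : d ≡ α * (α + 2)
  d≡ = trans (disc≡ α 0) (polynomial α)
    where
    polynomial : ∀ α → 1 * (α + suc α * (0 + α * 1)) ≡ α * (α + 2)
    polynomial = solve-∀

  P≡ : P ≡ 2 * α
  P≡ = 2*1+n∸2≡2*n α

  unit : a * a ≡ 1 + d * (1 * 1)
  unit = subst (λ d → a * a ≡ 1 + d * (1 * 1)) (sym d≡) (polynomial α)
    where
    polynomial : ∀ α → suc α * suc α ≡ 1 + α * (α + 2) * (1 * 1)
    polynomial = solve-∀

  -- Both coordinates are linear in `den bs` and `rem bs`, so once `P` and `d` are free of
  -- subtraction the claim is a pair of polynomial identities.
  turns : Turns d a 1 α (1 ∷ P ∷ [])
  turns bs rewrite d≡ | P≡ = cong₂ _,_ (numerators α (den bs) (rem bs)) (denominators α (den bs) (rem bs))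
    where
    numerators : ∀ α D R → α * (1 * (2 * α * D + R) + D) + (2 * α * D + R) ≡ suc α * (α * D + R) + α * (α + 2) * (1 * D)
    numerators = solve-∀
    denominators : ∀ α D R → 1 * (2 * α * D + R) + D ≡ suc α * D + 1 * (α * D + R)
    denominators = solve-∀

  -- Here a ≥ 2 is used: for a = 1 this quotient would be 0.
  1≤P : 1 ≤ P
  1≤P = subst (1 ≤_) (sym P≡) (*-mono-≤ (s≤s (z≤n {1})) 1≤α)

  expansion : √ d HasExpansion [ α ⨾‾ 1 ∷ P ∷ [] ]
  expansion = √-expansion {u = a} {1} (1 ∷ P ∷ []) 1≤α (≤-refl ∷ 1≤P ∷ []) unit (s≤s z≤n) ≤-refl turns

  fundamental : IsFundamental d a 1
  fundamental = isFundamental (s≤s z≤n) ≤-refl unit (λ 1≤y _ → 1≤y)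

  ratio : ∀ n x y → 1 ≤ n → IsNthSolution d n x y → RatioIs x y [ α ⨾ (1 ∷ P ∷ []) ⟨× n ∸ 1 ⟩ ++ 1 ∷ [] ]
  ratio = nthSolution-ratio fundamental turns (≤-refl ∷ 1≤P ∷ []) (≤-refl ∷ [])
    (trans (cong (_+ 1) (*-identityʳ α)) (+-comm α 1)) refl

-- The case b > 1, with unit 2a²b - 1 + 2a √d

module B>1 (α β : ℕ) (1≤α : 1 ≤ α) (1≤β : 1 ≤ β) where

  a b d u w M P N q : ℕ
  a = suc α
  b = suc β
  d = disc a b
  u = 2 * a ^ 2 * b ∸ 1
  w = 2 * a
  -- The head `a * b ∸ 1` of the theorem computes to this expression.
  M = β + α * suc β
  P = 2 * a ∸ 2
  N = 2 * a * b ∸ 2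
  -- This is a²b - 1, so that d = b q and u = 2 q + 1.
  q = α + a * M

  P≡ : P ≡ 2 * α
  P≡ = 2*1+n∸2≡2*n α

  N≡ : N ≡ 2 * M
  N≡ = trans (cong (_∸ 2) (*-assoc 2 a b)) (2*1+n∸2≡2*n M)

  u≡ : u ≡ 2 * q + 1
  u≡ = cong (_∸ 1) (trans (cong (λ s → 2 * s * b) (m^2≡m*m a)) (polynomial α β))
    where
    polynomial : ∀ α β → 2 * (suc α * suc α) * suc β ≡ suc (2 * (α + suc α * (β + α * suc β)) + 1)
    polynomial = solve-∀

  unit : u * u ≡ 1 + d * (w * w)
  unit = subst₂ (λ u d → u * u ≡ 1 + d * (w * w)) (sym u≡) (sym (disc≡ α β)) (polynomial α β)
    where
    polynomial : ∀ α β → (2 * (α + suc α * (β + α * suc β)) + 1) * (2 * (α + suc α * (β + α * suc β)) + 1)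
      ≡ 1 + suc β * (α + suc α * (β + α * suc β)) * (2 * suc α * (2 * suc α))
    polynomial = solve-∀

  turns : Turns d u w M (1 ∷ P ∷ 1 ∷ N ∷ [])
  turns bs rewrite disc≡ α β | P≡ | N≡ | u≡ = cong₂ _,_
    (numerators α β (den bs) (rem bs))
    (denominators α β (den bs) (rem bs))
    where
    -- `e`, `f` and `g` are the continuants `den` of `N ∷ bs`, `1 ∷ N ∷ bs` and `P ∷ 1 ∷ N ∷ bs`,
    -- built from the inside outwards.
    numerators : ∀ α β D R →
      let M = β + α * suc β
          q = α + suc α * M
          e = 2 * M * D + R
          f = 1 * e + D
          g = 2 * α * f + e
      in M * (1 * g + f) + g ≡ (2 * q + 1) * (M * D + R) + suc β * q * (2 * suc α * D)
    numerators = solve-∀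
    denominators : ∀ α β D R →
      let M = β + α * suc β
          q = α + suc α * M
          e = 2 * M * D + R
          f = 1 * e + D
          g = 2 * α * f + e
      in 1 * g + f ≡ (2 * q + 1) * D + 2 * suc α * (M * D + R)
    denominators = solve-∀

  1≤M : 1 ≤ M
  1≤M = ≤-trans 1≤β (m≤m+n β _)

  1≤P : 1 ≤ P
  1≤P = subst (1 ≤_) (sym P≡) (*-mono-≤ (s≤s (z≤n {1})) 1≤α)

  1≤N : 1 ≤ N
  1≤N = subst (1 ≤_) (sym N≡) (*-mono-≤ (s≤s (z≤n {1})) 1≤M)

  1≤u : 1 ≤ u
  1≤u = subst (1 ≤_) (sym u≡) (m≤n+m 1 (2 * q))

  expansion : √ d HasExpansion [ M ⨾‾ 1 ∷ P ∷ 1 ∷ N ∷ [] ]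
  expansion = √-expansion {u = u} {w} (1 ∷ P ∷ 1 ∷ N ∷ []) 1≤M (≤-refl ∷ 1≤P ∷ ≤-refl ∷ 1≤N ∷ [])
    unit 1≤u (s≤s z≤n) turns

  fundamental : IsFundamental d u w
  fundamental = isFundamental 1≤u (s≤s z≤n) unit λ {x} →
    least-denominator {a} {b} {d} {x} (s≤s 1≤β) (trans (cong (_+ b) (disc≡ α β)) (polynomial α β))
    where
    polynomial : ∀ α β → suc β * (α + suc α * (β + α * suc β)) + suc β ≡ suc α * suc β * (suc α * suc β)
    polynomial = solve-∀

  -- The last period stops before `N`: after the head `M`, the quotients 1, P, 1 give exactly u / w,
  -- which supplies the first power of the unit.
  ratio : ∀ n x y → 1 ≤ n → IsNthSolution d n x y →
    RatioIs x y [ M ⨾ (1 ∷ P ∷ 1 ∷ N ∷ []) ⟨× n ∸ 1 ⟩ ++ 1 ∷ P ∷ 1 ∷ [] ]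
  ratio = nthSolution-ratio fundamental turns (≤-refl ∷ 1≤P ∷ ≤-refl ∷ 1≤N ∷ []) (≤-refl ∷ 1≤P ∷ ≤-refl ∷ [])
    num-tail den-tail
    where
    numerators : ∀ α M → M * (1 * (2 * α * 1 + 1) + 1) + (2 * α * 1 + 1) ≡ 2 * (α + suc α * M) + 1
    numerators = solve-∀
    denominators : ∀ α → 1 * (2 * α * 1 + 1) + 1 ≡ 2 * suc α
    denominators = solve-∀
    num-tail : num M (1 ∷ P ∷ 1 ∷ []) ≡ u
    num-tail rewrite P≡ | u≡ = numerators α M
    den-tail : den (1 ∷ P ∷ 1 ∷ []) ≡ w
    den-tail rewrite P≡ = denominators α

theorem4 : (a b : ℕ) → 2 ≤ a → 1 ≤ b →
    ( (b ≡ 1 → √ disc a b HasExpansion [ a ∸ 1 ⨾‾ 1 ∷ 2 * a ∸ 2 ∷ [] ])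
    × (1 < b → √ disc a b HasExpansion [ a * b ∸ 1 ⨾‾ 1 ∷ 2 * a ∸ 2 ∷ 1 ∷ 2 * a * b ∸ 2 ∷ [] ]) )
    ×
    ( (b ≡ 1 → IsFundamental (disc a b) a 1)
    × (1 < b → IsFundamental (disc a b) (2 * a ^ 2 * b ∸ 1) (2 * a)) )
    ×
    ( (n x y : ℕ) → 1 ≤ n → IsNthSolution (disc a b) n x y →
    (b ≡ 1 → RatioIs x y [ a ∸ 1 ⨾ (1 ∷ 2 * a ∸ 2 ∷ []) ⟨× n ∸ 1 ⟩ ++ 1 ∷ [] ])
    × (1 < b → RatioIs x y [ a * b ∸ 1 ⨾ (1 ∷ 2 * a ∸ 2 ∷ 1 ∷ 2 * a * b ∸ 2 ∷ []) ⟨× n ∸ 1 ⟩ ++ 1 ∷ 2 * a ∸ 2 ∷ 1 ∷ [] ]) )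
theorem4 (suc α) (suc β) (s≤s 1≤α) _ =
  ((λ { refl → B≡1.expansion α 1≤α }) , λ { (s≤s 1≤β) → B>1.expansion α β 1≤α 1≤β }) ,
  ((λ { refl → B≡1.fundamental α 1≤α }) , λ { (s≤s 1≤β) → B>1.fundamental α β 1≤α 1≤β }) ,
  λ n x y 1≤n nth →
    (λ { refl → B≡1.ratio α 1≤α n x y 1≤n nth }) , λ { (s≤s 1≤β) → B>1.ratio α β 1≤α 1≤β n x y 1≤n nth }
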